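{- Given the offline ride-hitching problem with a set $\mathbb{V}=\{V_1,\dots,V_n\}$ of $n$ rides all known in advance, the algorithm \textsc{OptimalHitching} runs in $O(n^2)$ time and outputs the sequence of rides taken by an optimal offline solution, i.e. a feasible sequence $U$ of rides from $\mathbb{V}$ minimizing the UAV's arrival time $\xi(U)$ at the destination over all feasible sequences (including the empty one).
   Context: Setting. A UAV travels on the segment $[0,a]$ from the origin $O=0$ (at time $0$) to the destination $A=a$. It flies at speed $v_0>0$ (or stops), charges at all times at rate $\alpha>0$ per unit time, and while flying consumes power at rate $\beta>\alpha$ per unit time; its power must never be negative, and there is no upper limit on stored power. Its initial power $P_0$ satisfies $0\le P_0<\frac{(\beta-\alpha)a}{v_0}$. A truck ride is $V_i=(r_i,t_i,o_i,d_i,v_i)$: it is released (announced) at time $r_i$, departs at time $t_i\ge r_i$ from location $o_i$, and moves with constant velocity $v_i$ to $d_i$, where $0\le o_i<d_i\le a$. A UAV taking a ride boards it at $(o_i,t_i)$, leaves it at $d_i$ at time $t_i+\frac{d_i-o_i}{v_i}$, and charges without consuming power while on it. In the offline problem all rides are known at time $0$. Power transfer function: $\mathrm{PTF}(P,V_i,V_j)=P+(t_j-t_i)\alpha-\frac{|o_j-d_i|\beta}{v_0}$. Feasible sequences. A sequence $U=(V_1,\dots,V_{|U|})$ of rides (relabelled in the order taken) is feasible if $t_1\ge \frac{o_1}{v_0}$, $P_1:=P_0+t_1\alpha-\frac{o_1}{v_0}\beta\ge 0$, and for $1\le i<|U|$: $t_{i+1}\ge t_i+\frac{d_i-o_i}{v_i}+\frac{|o_{i+1}-d_i|}{v_0}$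 and $P_{i+1}:=\mathrm{PTF}(P_i,V_i,V_{i+1})\ge 0$. Its arrival time is $$\xi(U)=\max\Big\{\Big(o_1+\sum_{i=1}^{|U|-1}|o_{i+1}-d_i|+a-d_{|U|}\Big)\frac{\beta}{\alpha v_0}-\frac{P_0}{\alpha},\ t_{|U|}+\frac{d_{|U|}-o_{|U|}}{v_{|U|}}+\frac{a-d_{|U|}}{v_0}\Big\},$$ and $\xi(\varnothing)=\frac{\beta}{\alpha}\frac{a}{v_0}-\frac{P_0}{\alpha}$. Algorithm \textsc{OptimalHitching}. (1) Sort the rides by increasing start location as $V_1,\dots,V_n$. Create virtual nodes $V_0=(0,0,0,0,0)$ (representing $O$; its travel time $\frac{d_0-o_0}{v_0}$ is taken to be $0$) and $V_{n+1}$ (representing $A$). (2) Build a graph $G=(N,E,w)$ with node and edge weights. Start with $N=\{V_0\}$, $w(V_0)=P_0$, $E=\varnothing$. For $i=1,\dots,n$, let $\Phi(V_i)$ be the set of $V_j\in N$ compatible with $V_i$, i.e. with $t_i\ge t_j+\frac{d_j-o_j}{v_j}+\frac{|o_i-d_j|}{v_0}$ and $\mathrm{PTF}(w(V_j),V_j,V_i)\ge 0$. If $\Phi(V_i)\ne\varnothing$, let $V_*(i)\in\Phi(V_i)$ maximize $\mathrm{PTF}(w(V_j),V_j,V_i)$; add $V_i$ to $N$ with $w(V_i)=\mathrm{PTF}(w(V_*(i)),V_*(i),V_i)$ and add the edge $(V_*(i),V_i)$ with weight $0$. If $\Phi(V_i)=\varnothing$, skip $V_i$. After all rides are processed, add $V_{n+1}$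 to $N$ and, for each other $V_j\in N$, add the edge $(V_j,V_{n+1})$ with weight $$\xi(V_j)=t_j+\frac{d_j-o_j}{v_j}+\frac{a-d_j}{v_0}+\frac{1}{\alpha}\max\Big\{\frac{a-d_j}{v_0}(\beta-\alpha)-\Big(w(V_j)+\alpha\frac{d_j-o_j}{v_j}\Big),0\Big\}.$$ (3) Find $\overline V\in N\setminus\{V_{n+1}\}$ minimizing $w(\overline V,V_{n+1})$; follow edges backwards from $\overline V$ (each node other than $V_0$, $V_{n+1}$ is joined to exactly one node that entered $N$ earlier) until $V_0$ is reached; output the rides found, in the order they joined $N$. -}

module Defs where

open import Level using (_⊔_) renaming (suc to lsuc)
open import Algebra.Bundles using (CommutativeRing)
import Algebra.Construct.NaturalChoice.Max as Max
open import Data.Bool.Base using (Bool; not; _∧_; _∨_; if_then_else_)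
open import Data.List.Base using (List; []; _∷_)
open import Data.List.NonEmpty.Base using (List⁺; _∷_; toList; [_]; _∷⁺_)
open import Data.List.Relation.Binary.Subset.Propositional using (_⊆_)
open import Data.List.Relation.Unary.All using (All)
open import Data.Nat.Base as ℕ using (ℕ)
open import Data.Product.Base using (∃₂; _×_; _,_)
open import Relation.Binary.Bundles using (DecTotalOrder)
import Relation.Binary.Construct.NonStrictToStrict as NonStrictToStrict
open import Relation.Binary.Structures using (IsDecTotalOrder)
open import Relation.Nullary using (¬_)
open import Relation.Nullary.Decidable using (⌊_⌋)

-- The real numbers enter only through their structure of a totally ordered
-- field whose order can be tested (as a real RAM does).  The inverse is a
-- total function; nothing is assumed about 0# ⁻¹.

record OrderedField c ℓ₁ ℓ₂ : Set (lsuc (c ⊔ ℓ₁ ⊔ ℓ₂)) where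
  infix  4 _≤_
  infix  8 _⁻¹
  infixl 7 _/_

  field
    commutativeRing : CommutativeRing c ℓ₁

  open CommutativeRing commutativeRing public

  field
    _⁻¹             : Carrier → Carrier
    _≤_             : Carrier → Carrier → Set ℓ₂
    ⁻¹-cong         : ∀ {x y} → x ≈ y → x ⁻¹ ≈ y ⁻¹
    ⁻¹-inverseʳ     : ∀ {x} → ¬ (x ≈ 0#) → x * x ⁻¹ ≈ 1#
    1≉0             : ¬ (1# ≈ 0#)
    isDecTotalOrder : IsDecTotalOrder _≈_ _≤_
    +-monoˡ-≤       : ∀ z {x y} → x ≤ y → x + z ≤ y + z
    *-nonNeg        : ∀ {x y} → 0# ≤ x → 0# ≤ y → 0# ≤ x * y

  decTotalOrder : DecTotalOrder c ℓ₁ ℓ₂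
  decTotalOrder = record { isDecTotalOrder = isDecTotalOrder }

  open DecTotalOrder decTotalOrder public using (_≤?_; totalOrder)
  open NonStrictToStrict _≈_ _≤_ public using (_<_)

  max : Carrier → Carrier → Carrier
  max = Max._⊔_ totalOrder

  ∣_∣ : Carrier → Carrier
  ∣ x ∣ = max x (- x)

  _/_ : Carrier → Carrier → Carrier
  x / y = x * y ⁻¹

-- f bounds the worst case up to a constant, uniformly over all inputs.

RunsInO : ∀ {x} {X : Set x} → (ℕ → ℕ) → (size cost : X → ℕ) → Set x
RunsInO f size cost =
  ∃₂ λ C n₀ → ∀ x → n₀ ℕ.≤ size x → cost x ℕ.≤ C ℕ.* f (size x)

-- A computation together with the number of unit-cost steps it takes.

record Tick {a} (A : Set a) : Set a where
  constructor _after_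
  field
    value : A
    cost  : ℕ

open Tick public

module _ {a b} {A : Set a} {B : Set b} where

  infixl 1 _>>=_

  _>>=_ : Tick A → (A → Tick B) → Tick B
  m >>= f = value (f (value m)) after (cost m ℕ.+ cost (f (value m)))

return : ∀ {a} {A : Set a} → A → Tick A
return x = x after 0

infixr 0 ✓_

✓_ : ∀ {a} {A : Set a} → Tick A → Tick A
✓ m = value m after ℕ.suc (cost m)

module Hitching {c ℓ₁ ℓ₂} (F : OrderedField c ℓ₁ ℓ₂) where

  open OrderedField F

  -- Cost accounting: every field operation and every comparison costs one
  -- step, and in the algorithm below so does every recursive call.

  module RAM where
    infixl 6 _⊕_ _⊖_
    infixl 7 _⊗_ _⊘_
    infix  4 _≤ᵇ_

    lift₂ : ∀ {b} {B : Set b} →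
            (Carrier → Carrier → B) → Tick Carrier → Tick Carrier → Tick B
    lift₂ f m n = m >>= λ x → n >>= λ y → ✓ return (f x y)

    _⊕_ _⊖_ _⊗_ _⊘_ maxₜ : Tick Carrier → Tick Carrier → Tick Carrier
    _⊕_  = lift₂ _+_
    _⊖_  = lift₂ _-_
    _⊗_  = lift₂ _*_
    _⊘_  = lift₂ _/_
    maxₜ = lift₂ max

    absₜ : Tick Carrier → Tick Carrier
    absₜ m = m >>= λ x → ✓ return ∣ x ∣

    _≤ᵇ_ : Tick Carrier → Tick Carrier → Tick Bool
    _≤ᵇ_ = lift₂ λ x y → ⌊ x ≤? y ⌋

  record Ride : Set c where
    constructor mkRide
    field
      r t o d v : Carrier

  open Ride public

  record IsRide (a : Carrier) (V : Ride) : Set (ℓ₁ ⊔ ℓ₂) where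
    field
      r≤t : r V ≤ t V
      0≤o : 0# ≤ o V
      o<d : o V < d V
      d≤a : d V ≤ a
      0<v : 0# < v V

  -- For V₀ this is 0# * 0# ⁻¹, which is 0# whatever 0# ⁻¹ is.

  travel : Ride → Carrier
  travel V = (d V - o V) / v V

  V₀ : Ride
  V₀ = mkRide 0# 0# 0# 0# 0#

  record Problem : Set (c ⊔ ℓ₁ ⊔ ℓ₂) where
    field
      a v₀ α β P₀ : Carrier
      rides       : List Ride
      0<v₀        : 0# < v₀
      0<α         : 0# < α
      α<β         : α < β
      0≤P₀        : 0# ≤ P₀
      P₀<need     : P₀ < ((β - α) * a) / v₀
      areRides    : All (IsRide a) rides

  module Model (I : Problem) where
    open Problem I

    PTF : Carrier → Ride → Ride → Carrier
    PTF P Vᵢ Vⱼ = P + (t Vⱼ - t Vᵢ) * α - (∣ o Vⱼ - d Vᵢ ∣ * β) / v₀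

    -- FeasibleFrom P V U: having boarded V with power P, the UAV can go on to
    -- take the rides U.

    data FeasibleFrom : Carrier → Ride → List Ride → Set (c ⊔ ℓ₂) where
      end  : ∀ {P V} → FeasibleFrom P V []
      next : ∀ {P V V′ U} →
             t V + travel V + ∣ o V′ - d V ∣ / v₀ ≤ t V′ →
             0# ≤ PTF P V V′ →
             FeasibleFrom (PTF P V V′) V′ U →
             FeasibleFrom P V (V′ ∷ U)

    P₁ : Ride → Carrier
    P₁ V = P₀ + t V * α - (o V / v₀) * β

    data Feasible : List Ride → Set (c ⊔ ℓ₂) where
      empty : Feasible []
      start : ∀ {V U} →
              o V / v₀ ≤ t V →
              0# ≤ P₁ V →
              FeasibleFrom (P₁ V) V U →
              Feasible (V ∷ U)

    gaps : Ride → List Ride → Carrier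
    gaps V []       = 0#
    gaps V (V′ ∷ U) = ∣ o V′ - d V ∣ + gaps V′ U

    lastRide : Ride → List Ride → Ride
    lastRide V []       = V
    lastRide V (V′ ∷ U) = lastRide V′ U

    ξ : List Ride → Carrier
    ξ []      = (β / α) * (a / v₀) - P₀ / α
    ξ (V ∷ U) =
      let L = lastRide V U in
      max ((o V + gaps V U + (a - d L)) * (β / (α * v₀)) - P₀ / α)
          (t L + travel L + (a - d L) / v₀)

    IsSolution : List Ride → Set (c ⊔ ℓ₂)
    IsSolution U = U ⊆ rides × Feasible U

    IsOptimal : List Ride → Set (c ⊔ ℓ₂)
    IsOptimal U = IsSolution U × (∀ U′ → IsSolution U′ → ξ U ≤ ξ U′)

  -- A node of N other than Vₙ₊₁: V₀, or a ride with its node weight and the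
  -- tail of the unique (weight 0) edge entering it.  The graph without its
  -- sink is thus the list of its nodes.

  data Node : Set c where
    origin : Node
    node   : (V : Ride) (w : Carrier) (pred : Node) → Node

  -- Both choices of an extremal node leave ties open; they are resolved by an
  -- arbitrary oracle, for V*(i) possibly depending on Vᵢ.  (Ties in the sort
  -- keep the arbitrary input order.)

  record TieBreak : Set c where
    field
      preferPred : Ride → Node → Node → Bool
      preferLast : Node → Node → Bool

  insert : Ride → List Ride → Tick (List Ride)
  insert V []       = ✓ return (V ∷ [])
  insert V (W ∷ Ws) = ✓ do
    b ← return (o V) ≤ᵇ return (o W)
    if b then return (V ∷ W ∷ Ws)
         else (do Ws′ ← insert V Ws
                  return (W ∷ Ws′))
    where open RAM

  sort : List Ride → Tick (List Ride)
  sort []       = ✓ return []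
  sort (V ∷ Vs) = ✓ do
    Vs′ ← sort Vs
    insert V Vs′

  -- A node that is extremal for the total preorder `le` on keys, among a node
  -- and a list of further nodes, each given with its key.

  Keyed : Set c
  Keyed = Carrier × Node

  select : (le : Carrier → Carrier → Tick Bool) (prefer : Node → Node → Bool) →
           Keyed → List Keyed → Tick Keyed
  select le prefer best      []              = ✓ return best
  select le prefer (x , M) ((y , M′) ∷ rest) = ✓ do
    x≼y ← le x y
    y≼x ← le y x
    switch ← ✓ return (x≼y ∧ (not y≼x ∨ prefer M M′))
    select le prefer (if switch then (y , M′) else (x , M)) rest

  argmax argmin : (Node → Node → Bool) → Keyed → List Keyed → Tick Keyed
  argmax = select λ x y → RAM._≤ᵇ_ (return x) (return y)
  argmin = select λ x y → RAM._≤ᵇ_ (return y) (return x)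

  traceBack : Node → List Ride → Tick (List Ride)
  traceBack origin       U = ✓ return U
  traceBack (node V _ M) U = ✓ traceBack M (V ∷ U)

  module Algorithm (I : Problem) (τ : TieBreak) where
    open Problem I
    open TieBreak τ
    open RAM

    ride : Node → Ride
    ride origin       = V₀
    ride (node V _ _) = V

    weight : Node → Carrier
    weight origin       = P₀
    weight (node _ w _) = w

    travelₜ : Ride → Tick Carrier
    travelₜ V = (return (d V) ⊖ return (o V)) ⊘ return (v V)

    ptf : Carrier → Ride → Ride → Tick Carrier
    ptf P Vᵢ Vⱼ =
      return P ⊕ (return (t Vⱼ) ⊖ return (t Vᵢ)) ⊗ return α
        ⊖ (absₜ (return (o Vⱼ) ⊖ return (d Vᵢ)) ⊗ return β) ⊘ return v₀

    Φ : Ride → List Node → Tick (List Keyed)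
    Φ V []       = ✓ return []
    Φ V (M ∷ Ms) = ✓ do
      let W = ride M
      p       ← ptf (weight M) W V
      inTime  ← return (t W) ⊕ travelₜ W
                  ⊕ absₜ (return (o V) ⊖ return (d W)) ⊘ return v₀
                ≤ᵇ return (t V)
      powered ← return 0# ≤ᵇ return p
      rest    ← Φ V Ms
      return (if inTime ∧ powered then (p , M) ∷ rest else rest)

    addRide : Ride → List⁺ Node → Tick (List⁺ Node)
    addRide V N = ✓ (Φ V (toList N) >>= join)
      where
      join : List Keyed → Tick (List⁺ Node)
      join []            = return N
      join (pM ∷ others) = do
        (p , M) ← argmax (preferPred V) pM others
        return (node V p M ∷⁺ N)

    addRides : List Ride → List⁺ Node → Tick (List⁺ Node)
    addRides []       N = ✓ return N
    addRides (V ∷ Vs) N = ✓ do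
      N′ ← addRide V N
      addRides Vs N′

    sinkWeight : Node → Tick Carrier
    sinkWeight M =
      return (t V) ⊕ travelₜ V ⊕ toGo
        ⊕ (return 1# ⊘ return α)
          ⊗ maxₜ (toGo ⊗ (return β ⊖ return α)
                    ⊖ (return (weight M) ⊕ return α ⊗ travelₜ V))
                 (return 0#)
      where
      V    = ride M
      toGo = (return a ⊖ return (d V)) ⊘ return v₀

    sinkEdges : List Node → Tick (List Keyed)
    sinkEdges []       = ✓ return []
    sinkEdges (M ∷ Ms) = ✓ do
      x    ← sinkWeight M
      rest ← sinkEdges Ms
      return ((x , M) ∷ rest)

    optimalHitching : Tick (List Ride)
    optimalHitching = do
      Vs      ← sort rides
      M ∷ Ms  ← addRides Vs [ origin ]
      x       ← sinkWeight M
      edges   ← sinkEdges Ms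
      (_ , L) ← argmin preferLast (x , M) edges
      traceBack L []

  open Problem public using (rides)
  open Model public using (IsOptimal)

  OptimalHitching : Problem → TieBreak → Tick (List Ride)
  OptimalHitching = Algorithm.optimalHitching

{-# OPTIONS --safe #-}

-- A ride W taken after V′ although W does not start further ahead than V′ makes
-- V′ useless: flying straight to W is no longer than the two flights around V′,
-- so dropping V′ costs neither time nor power.  Hence only sequences with
-- increasing start locations matter, and a dynamic programme over the sorted
-- rides finds them.  Since a ride departs at a fixed time, more power when
-- boarding it is always better, so the best power is all that needs to be
-- remembered for a ride; the arrival time depends on the sequence only through
-- its last ride and the power when boarding that, and decreases in the power.

module Submission where

open import Defs
open import Algebra.Bundles using (CommutativeRing)
import Algebra.Construct.NaturalChoice.Max as Max
import Algebra.Properties.Ring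
import Algebra.Properties.Semiring.Mult
import Algebra.Solver.Ring
open import Algebra.Solver.Ring.AlmostCommutativeRing
  using (fromCommutativeRing; _-Raw-AlmostCommutative⟶_)
open import Data.Bool.Base using (Bool; true; false; _∧_)
open import Data.Empty using (⊥-elim)
open import Data.Integer.Base as ℤ using (ℤ)
import Data.Integer.Properties as ℤ
open import Data.List.Base using (List; []; _∷_; length; map)
open import Data.List.Membership.Propositional using (_∈_)
open import Data.List.Membership.Propositional.Properties using (∈-map⁺; ∈-map⁻)
open import Data.List.NonEmpty.Base using (List⁺; _∷_; head; tail; toList; [_]; _∷⁺_)
open import Data.List.Relation.Binary.Permutation.Propositional as ↭ using (_↭_; ↭-sym)
open import Data.List.Relation.Binary.Permutation.Propositional.Properties
  using (All-resp-↭; ∈-resp-↭; ↭-length)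
open import Data.List.Relation.Binary.Subset.Propositional using (_⊆_)
open import Data.List.Relation.Unary.All as All using (All; []; _∷_)
open import Data.List.Relation.Unary.AllPairs using (AllPairs; []; _∷_)
open import Data.List.Relation.Unary.Any using (here; there)
open import Data.Maybe.Base as Maybe using ()
open import Data.Nat.Base as ℕ using (ℕ; zero; suc; _^_)
open import Data.Nat.Tactic.RingSolver using (solve-∀)
open import Data.Product.Base using (∃; ∃₂; _×_; _,_; proj₁; proj₂)
open import Data.Sign.Base as Sign using (Sign)
open import Data.Sum.Base as Sum using (_⊎_; inj₁; inj₂)
open import Function.Base using (_∘_; case_of_; id)
open import Level using (_⊔_)
open import Relation.Binary.Bundles using (DecTotalOrder)
import Relation.Binary.Construct.Flip.EqAndOrd as Flip
open import Relation.Binary.Core using (Rel)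
open import Relation.Binary.PropositionalEquality as ≡ using (_≡_)
import Relation.Binary.Reasoning.PartialOrder
import Relation.Binary.Reasoning.Setoid
open import Relation.Binary.Structures using (IsDecTotalOrder)
open import Relation.Nullary using (¬_; yes; no; contradiction)
open import Relation.Nullary.Decidable using (⌊_⌋; dec⇒maybe)

-- A ring solver with integer coefficients.

-- The ring solver needs coefficients with computing equality, hence ℤ.

module IntegerSolver {c ℓ} (R : CommutativeRing c ℓ) where
  open import Data.Integer.Base using (+_; -[1+_]; _⊖_; _◃_)
  open CommutativeRing R
  open Algebra.Properties.Ring ring
  open Algebra.Properties.Semiring.Mult semiring renaming (_×_ to _·_)
  open Relation.Binary.Reasoning.Setoid setoid

  fromℤ : ℤ → Carrier
  fromℤ (+ n)    = n · 1#
  fromℤ -[1+ n ] = - (suc n · 1#)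

  fromℤ-⊖ : ∀ m n → fromℤ (m ⊖ n) ≈ m · 1# - n · 1#
  fromℤ-⊖ m zero = begin
    m · 1#       ≈⟨ +-identityʳ _ ⟨
    m · 1# + 0#  ≈⟨ +-congˡ -0#≈0# ⟨
    m · 1# - 0#  ∎
  fromℤ-⊖ zero (suc n) = sym (+-identityˡ _)
  fromℤ-⊖ (suc m) (suc n) = begin
    fromℤ (suc m ⊖ suc n)                    ≡⟨ ≡.cong fromℤ (ℤ.[1+m]⊖[1+n]≡m⊖n m n) ⟩
    fromℤ (m ⊖ n)                            ≈⟨ fromℤ-⊖ m n ⟩
    m · 1# - n · 1#                          ≈⟨ +-congʳ (+-identityʳ _) ⟨
    m · 1# + 0# - n · 1#                     ≈⟨ +-congʳ (+-congˡ (-‿inverseʳ 1#)) ⟨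
    m · 1# + (1# - 1#) - n · 1#              ≈⟨ +-congʳ (+-assoc _ _ _) ⟨
    m · 1# + 1# - 1# - n · 1#                ≈⟨ +-congʳ (+-congʳ (+-comm _ _)) ⟩
    1# + m · 1# - 1# - n · 1#                ≈⟨ +-assoc _ _ _ ⟩
    1# + m · 1# + (- 1# - n · 1#)            ≈⟨ +-congˡ (-‿+-comm 1# (n · 1#)) ⟩
    1# + m · 1# - (1# + n · 1#)              ∎

  fromℤ-+ : ∀ i j → fromℤ (i ℤ.+ j) ≈ fromℤ i + fromℤ j
  fromℤ-+ (+ m)    (+ n)    = ×-homo-+ 1# m n
  fromℤ-+ (+ m)    -[1+ n ] = fromℤ-⊖ m (suc n)
  fromℤ-+ -[1+ m ] (+ n)    = trans (fromℤ-⊖ n (suc m)) (+-comm _ _)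
  fromℤ-+ -[1+ m ] -[1+ n ] = begin
    - (suc (suc (m ℕ.+ n)) · 1#)        ≈⟨ -‿cong (+-congˡ (×-homo-+ 1# (suc m) n)) ⟩
    - (1# + (suc m · 1# + n · 1#))      ≈⟨ -‿cong (+-assoc _ _ _) ⟨
    - (1# + suc m · 1# + n · 1#)        ≈⟨ -‿cong (+-congʳ (+-comm _ _)) ⟩
    - (suc m · 1# + 1# + n · 1#)        ≈⟨ -‿cong (+-assoc _ _ _) ⟩
    - (suc m · 1# + suc n · 1#)         ≈⟨ -‿+-comm _ _ ⟨
    - (suc m · 1#) - suc n · 1#         ∎

  signed : Sign → Carrier → Carrier
  signed Sign.+ x = x
  signed Sign.- x = - x

  fromℤ-◃ : ∀ s n → fromℤ (s ◃ n) ≈ signed s (n · 1#)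
  fromℤ-◃ Sign.+ zero    = refl
  fromℤ-◃ Sign.- zero    = sym -0#≈0#
  fromℤ-◃ Sign.+ (suc n) = refl
  fromℤ-◃ Sign.- (suc n) = refl

  fromℤ-sign-abs : ∀ i → signed (ℤ.sign i) (ℤ.∣ i ∣ · 1#) ≈ fromℤ i
  fromℤ-sign-abs (+ n)    = refl
  fromℤ-sign-abs -[1+ n ] = refl

  signed-cong : ∀ s {x y} → x ≈ y → signed s x ≈ signed s y
  signed-cong Sign.+ x≈y = x≈y
  signed-cong Sign.- x≈y = -‿cong x≈y

  signed-* : ∀ s t x y → signed (s Sign.* t) (x * y) ≈ signed s x * signed t y
  signed-* Sign.+ Sign.+ x y = refl
  signed-* Sign.+ Sign.- x y = -‿distribʳ-* x y
  signed-* Sign.- Sign.+ x y = -‿distribˡ-* x y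
  signed-* Sign.- Sign.- x y = begin
    x * y          ≈⟨ -‿involutive _ ⟨
    - - (x * y)    ≈⟨ -‿cong (-‿distribˡ-* x y) ⟩
    - (- x * y)    ≈⟨ -‿distribʳ-* (- x) y ⟩
    - x * - y      ∎

  -- Integer multiplication is defined through signs and absolute values, so the two are treated
  -- separately: `signed` carries the sign and `×1-homo-*` the natural numbers.
  fromℤ-* : ∀ i j → fromℤ (i ℤ.* j) ≈ fromℤ i * fromℤ j
  fromℤ-* i j = begin
    fromℤ (s Sign.* t ◃ m ℕ.* n)                 ≈⟨ fromℤ-◃ (s Sign.* t) (m ℕ.* n) ⟩
    signed (s Sign.* t) ((m ℕ.* n) · 1#)         ≈⟨ signed-cong (s Sign.* t) (×1-homo-* m n) ⟩
    signed (s Sign.* t) ((m · 1#) * (n · 1#))    ≈⟨ signed-* s t _ _ ⟩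
    signed s (m · 1#) * signed t (n · 1#)        ≈⟨ *-cong (fromℤ-sign-abs i) (fromℤ-sign-abs j) ⟩
    fromℤ i * fromℤ j                            ∎
    where
    s = ℤ.sign i
    t = ℤ.sign j
    m = ℤ.∣ i ∣
    n = ℤ.∣ j ∣

  fromℤ-neg : ∀ i → fromℤ (ℤ.- i) ≈ - fromℤ i
  fromℤ-neg (+ zero)  = sym -0#≈0#
  fromℤ-neg (+ suc n) = refl
  fromℤ-neg -[1+ n ]  = sym (-‿involutive _)

  fromℤ-homomorphism : ℤ.+-*-rawRing -Raw-AlmostCommutative⟶ fromCommutativeRing R
  fromℤ-homomorphism = record
    { ⟦_⟧    = fromℤ
    ; +-homo = fromℤ-+
    ; *-homo = fromℤ-*
    ; -‿homo = fromℤ-neg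
    ; 0-homo = refl
    ; 1-homo = +-identityʳ 1#
    }

  open Algebra.Solver.Ring ℤ.+-*-rawRing (fromCommutativeRing R) fromℤ-homomorphism
    (λ i j → Maybe.map (λ i≡j → reflexive (≡.cong fromℤ i≡j)) (dec⇒maybe (i ℤ.≟ j)))
    public using (solve; con; _:=_; _:+_; _:*_; _:-_; :-_)

-- Inequalities in an ordered field.

module OrderedFieldProperties {c ℓ₁ ℓ₂} (F : OrderedField c ℓ₁ ℓ₂) where
  open OrderedField F
  open IntegerSolver commutativeRing
  open Algebra.Properties.Ring ring using (-0#≈0#)
  module ≤ = DecTotalOrder decTotalOrder
  module ⊔ = Max totalOrder
  module ≤-Reasoning = Relation.Binary.Reasoning.PartialOrder ≤.poset
  open ≤-Reasoning

  +-monoʳ-≤ : ∀ z {x y} → x ≤ y → z + x ≤ z + y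
  +-monoʳ-≤ z {x} {y} x≤y = begin
    z + x  ≈⟨ +-comm z x ⟩
    x + z  ≤⟨ +-monoˡ-≤ z x≤y ⟩
    y + z  ≈⟨ +-comm y z ⟩
    z + y  ∎

  +-mono-≤ : ∀ {x y z w} → x ≤ y → z ≤ w → x + z ≤ y + w
  +-mono-≤ {y = y} {z} x≤y z≤w = ≤.trans (+-monoˡ-≤ z x≤y) (+-monoʳ-≤ y z≤w)

  x≤x+y : ∀ {x y} → 0# ≤ y → x ≤ x + y
  x≤x+y {x} {y} 0≤y = begin
    x       ≈⟨ +-identityʳ x ⟨
    x + 0#  ≤⟨ +-monoʳ-≤ x 0≤y ⟩
    x + y   ∎

  x≤y⇒0≤y-x : ∀ {x y} → x ≤ y → 0# ≤ y - x
  x≤y⇒0≤y-x {x} {y} x≤y = begin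
    0#     ≈⟨ -‿inverseʳ x ⟨
    x - x  ≤⟨ +-monoˡ-≤ (- x) x≤y ⟩
    y - x  ∎

  0≤y-x⇒x≤y : ∀ {x y} → 0# ≤ y - x → x ≤ y
  0≤y-x⇒x≤y {x} {y} 0≤y-x = begin
    x            ≤⟨ x≤x+y 0≤y-x ⟩
    x + (y - x)  ≈⟨ solve 2 (λ x y → x :+ (y :- x) := y) refl x y ⟩
    y            ∎

  neg-antimono-≤ : ∀ {x y} → x ≤ y → - y ≤ - x
  neg-antimono-≤ {x} {y} x≤y = 0≤y-x⇒x≤y (≤.≤-respʳ-≈
    (solve 2 (λ x y → y :- x := :- x :- (:- y)) refl x y) (x≤y⇒0≤y-x x≤y))

  x≤0⇒0≤-x : ∀ {x} → x ≤ 0# → 0# ≤ - x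
  x≤0⇒0≤-x x≤0 = ≤.≤-respˡ-≈ -0#≈0# (neg-antimono-≤ x≤0)

  *-monoˡ-≤ : ∀ {z x y} → 0# ≤ z → x ≤ y → x * z ≤ y * z
  *-monoˡ-≤ {z} {x} {y} 0≤z x≤y = 0≤y-x⇒x≤y (≤.≤-respʳ-≈
    (solve 3 (λ x y z → (y :- x) :* z := y :* z :- x :* z) refl x y z)
    (*-nonNeg (x≤y⇒0≤y-x x≤y) 0≤z))

  *-monoʳ-≤ : ∀ {z x y} → 0# ≤ z → x ≤ y → z * x ≤ z * y
  *-monoʳ-≤ {z} {x} {y} 0≤z x≤y = begin
    z * x  ≈⟨ *-comm z x ⟩
    x * z  ≤⟨ *-monoˡ-≤ 0≤z x≤y ⟩
    y * z  ≈⟨ *-comm y z ⟩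
    z * y  ∎

  0≤x² : ∀ x → 0# ≤ x * x
  0≤x² x with ≤.total 0# x
  ... | inj₁ 0≤x = *-nonNeg 0≤x 0≤x
  ... | inj₂ x≤0 = ≤.≤-respʳ-≈ (solve 1 (λ x → :- x :* :- x := x :* x) refl x)
    (*-nonNeg (x≤0⇒0≤-x x≤0) (x≤0⇒0≤-x x≤0))

  0≤1 : 0# ≤ 1#
  0≤1 = ≤.≤-respʳ-≈ (*-identityʳ 1#) (0≤x² 1#)

  <⇒≉0 : ∀ {x} → 0# < x → ¬ (x ≈ 0#)
  <⇒≉0 (_ , 0≉x) x≈0 = 0≉x (sym x≈0)

  -- A nonpositive inverse would make `x * - (x ⁻¹)`, which is -1, nonnegative, against `0≤1`.
  0≤x⁻¹ : ∀ {x} → 0# < x → 0# ≤ x ⁻¹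
  0≤x⁻¹ {x} 0<x with ≤.total 0# (x ⁻¹)
  ... | inj₁ 0≤x⁻¹ = 0≤x⁻¹
  ... | inj₂ x⁻¹≤0 = ⊥-elim (1≉0 (≤.antisym 1≤0 0≤1))
    where
    1≤0 : 1# ≤ 0#
    1≤0 = 0≤y-x⇒x≤y (begin
      0#             ≤⟨ *-nonNeg (proj₁ 0<x) (x≤0⇒0≤-x x⁻¹≤0) ⟩
      x * - (x ⁻¹)   ≈⟨ solve 2 (λ x y → x :* :- y := con (ℤ.+ 0) :- x :* y) refl x (x ⁻¹) ⟩
      0# - x * x ⁻¹  ≈⟨ +-congˡ (-‿cong (⁻¹-inverseʳ (<⇒≉0 0<x))) ⟩
      0# - 1#        ∎)

  0≤x/y : ∀ {x y} → 0# ≤ x → 0# < y → 0# ≤ x / y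
  0≤x/y 0≤x 0<y = *-nonNeg 0≤x (0≤x⁻¹ 0<y)

  -- Multiplying by `1#` in the form `(x * x ⁻¹) * (y * y ⁻¹)` lets `x * y` cancel against its
  -- inverse. This splits the factor `β / (α * v₀)` in `ξ`, so that the solver can treat the two
  -- inverses as separate variables.
  ⁻¹-distrib-* : ∀ {x y} → 0# < x → 0# < y → (x * y) ⁻¹ ≈ x ⁻¹ * y ⁻¹
  ⁻¹-distrib-* {x} {y} 0<x 0<y = begin-equality
    (x * y) ⁻¹                                  ≈⟨ *-identityʳ _ ⟨
    (x * y) ⁻¹ * 1#                             ≈⟨ *-congˡ 1≈ ⟨
    (x * y) ⁻¹ * ((x * x ⁻¹) * (y * y ⁻¹))      ≈⟨ solve 5 (λ x y x′ y′ z →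
      z :* ((x :* x′) :* (y :* y′)) := ((x :* y) :* z) :* (x′ :* y′))
      refl x y (x ⁻¹) (y ⁻¹) ((x * y) ⁻¹) ⟩
    ((x * y) * (x * y) ⁻¹) * (x ⁻¹ * y ⁻¹)      ≈⟨ *-congʳ (⁻¹-inverseʳ xy≉0) ⟩
    1# * (x ⁻¹ * y ⁻¹)                          ≈⟨ *-identityˡ _ ⟩
    x ⁻¹ * y ⁻¹                                 ∎
    where
    1≈ : (x * x ⁻¹) * (y * y ⁻¹) ≈ 1#
    1≈ = trans (*-cong (⁻¹-inverseʳ (<⇒≉0 0<x)) (⁻¹-inverseʳ (<⇒≉0 0<y))) (*-identityʳ 1#)

    xy≉0 : ¬ (x * y ≈ 0#)
    xy≉0 xy≈0 = 1≉0 (begin-equality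
      1#                           ≈⟨ 1≈ ⟨
      (x * x ⁻¹) * (y * y ⁻¹)      ≈⟨ solve 4 (λ x y x′ y′ →
        (x :* x′) :* (y :* y′) := (x :* y) :* (x′ :* y′)) refl x y (x ⁻¹) (y ⁻¹) ⟩
      (x * y) * (x ⁻¹ * y ⁻¹)      ≈⟨ *-congʳ xy≈0 ⟩
      0# * (x ⁻¹ * y ⁻¹)           ≈⟨ zeroˡ _ ⟩
      0#                           ∎)

  x≤∣x∣ : ∀ x → x ≤ ∣ x ∣
  x≤∣x∣ x = ⊔.x≤x⊔y x (- x)

  -x≤∣x∣ : ∀ x → - x ≤ ∣ x ∣
  -x≤∣x∣ x = ⊔.x≤y⊔x x (- x)

  0≤x⇒-x≤x : ∀ {x} → 0# ≤ x → - x ≤ x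
  0≤x⇒-x≤x {x} 0≤x = begin
    - x   ≤⟨ neg-antimono-≤ 0≤x ⟩
    - 0#  ≈⟨ -0#≈0# ⟩
    0#    ≤⟨ 0≤x ⟩
    x     ∎

  0≤x⇒∣x∣≈x : ∀ {x} → 0# ≤ x → ∣ x ∣ ≈ x
  0≤x⇒∣x∣≈x 0≤x = ⊔.x≤y⇒y⊔x≈y (0≤x⇒-x≤x 0≤x)

  0≤∣x∣ : ∀ x → 0# ≤ ∣ x ∣
  0≤∣x∣ x with ≤.total 0# x
  ... | inj₁ 0≤x = ≤.trans 0≤x (x≤∣x∣ x)
  ... | inj₂ x≤0 = ≤.trans (x≤0⇒0≤-x x≤0) (-x≤∣x∣ x)

  ∣∣-cong : ∀ {x y} → x ≈ y → ∣ x ∣ ≈ ∣ y ∣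
  ∣∣-cong x≈y = ⊔.⊔-cong x≈y (-‿cong x≈y)

  -- An affine map of nonnegative slope is monotone, and monotone maps commute with `max`.
  max-homo : ∀ {p q} → 0# ≤ q → ∀ x y → p + q * max x y ≈ max (p + q * x) (p + q * y)
  max-homo {p} {q} 0≤q = ⊔.mono-≤-distrib-⊔ {f = λ z → p + q * z}
    (λ x≈y → +-congˡ (*-congˡ x≈y)) (λ x≤y → +-monoʳ-≤ p (*-monoʳ-≤ 0≤q x≤y))

-- Correctness of extremal selection and insertion sort.

module Search {c ℓ₁ ℓ₂} (F : OrderedField c ℓ₁ ℓ₂) where
  open OrderedField F
  open Hitching F

  module Selection {ℓ} {_≼_ : Rel Carrier ℓ} (≼-isDecTotalOrder : IsDecTotalOrder _≈_ _≼_)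
                   (prefer : Node → Node → Bool) where
    open IsDecTotalOrder ≼-isDecTotalOrder
      using (total) renaming (refl to ≼-refl; trans to ≼-trans; _≤?_ to _≼?_)

    -- The comparison given to `select` by `argmax`, and by `argmin` over the flipped order, unfolds
    -- to `le` in value and cost, so one proof covers both.
    le : Carrier → Carrier → Tick Bool
    le x y = ⌊ x ≼? y ⌋ after 1

    Extremal : Keyed → List Keyed → Set _
    Extremal (x , M) kMs = (x , M) ∈ kMs × All (λ (y , _) → y ≼ x) kMs

    -- Whichever of the current best and the next candidate is kept lies above the other, so
    -- transitivity passes the bound on. In a tie both comparisons hold, so either choice is sound;
    -- totality excludes two failing comparisons.
    select-extremal : ∀ best rest →
                      Extremal (value (select le prefer best rest)) (best ∷ rest)
    select-extremal best [] = here ≡.refl , ≼-refl ∷ []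
    select-extremal (x , M) ((y , M′) ∷ rest) with x ≼? y | y ≼? x | prefer M M′
    ... | no x⋠y | no y⋠x | _ with total x y
    ...   | inj₁ x≼y = contradiction x≼y x⋠y
    ...   | inj₂ y≼x = contradiction y≼x y⋠x
    select-extremal (x , M) ((y , M′) ∷ rest)
      | yes x≼y | no _ | _ with select-extremal (y , M′) rest
    ...   | ∈rest , y≼z ∷ rest≼z = there ∈rest , ≼-trans x≼y y≼z ∷ y≼z ∷ rest≼z
    select-extremal (x , M) ((y , M′) ∷ rest)
      | yes x≼y | yes _ | true with select-extremal (y , M′) rest
    ...   | ∈rest , y≼z ∷ rest≼z = there ∈rest , ≼-trans x≼y y≼z ∷ y≼z ∷ rest≼z
    select-extremal (x , M) ((y , M′) ∷ rest)
      | yes _ | yes y≼x | false with select-extremal (x , M) rest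
    ...   | here eq , x≼z ∷ rest≼z = here eq , x≼z ∷ ≼-trans y≼x x≼z ∷ rest≼z
    ...   | there ∈rest , x≼z ∷ rest≼z =
      there (there ∈rest) , x≼z ∷ ≼-trans y≼x x≼z ∷ rest≼z
    select-extremal (x , M) ((y , M′) ∷ rest)
      | no _ | yes y≼x | _ with select-extremal (x , M) rest
    ...   | here eq , x≼z ∷ rest≼z = here eq , x≼z ∷ ≼-trans y≼x x≼z ∷ rest≼z
    ...   | there ∈rest , x≼z ∷ rest≼z =
      there (there ∈rest) , x≼z ∷ ≼-trans y≼x x≼z ∷ rest≼z

    -- Each further candidate costs two comparisons, the test for switching and a call.
    cost-select : ∀ best rest → cost (select le prefer best rest) ≡ 1 ℕ.+ 4 ℕ.* length rest
    cost-select best [] = ≡.refl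
    cost-select best (_ ∷ rest) =
      ≡.trans (≡.cong (4 ℕ.+_) (cost-select _ rest)) (arith (length rest))
      where
      arith : ∀ n → 4 ℕ.+ (1 ℕ.+ 4 ℕ.* n) ≡ 1 ℕ.+ 4 ℕ.* suc n
      arith = solve-∀

  module ArgMax = Selection isDecTotalOrder
  module ArgMin = Selection (Flip.isDecTotalOrder isDecTotalOrder)

  Sorted : List Ride → Set _
  Sorted = AllPairs (λ V W → o V ≤ o W)

  insert-↭ : ∀ V Ws → value (insert V Ws) ↭ V ∷ Ws
  insert-↭ V [] = ↭.refl
  insert-↭ V (W ∷ Ws) with o V ≤? o W
  ... | yes _ = ↭.refl
  ... | no _  = ↭.trans (↭.prep W (insert-↭ V Ws)) (↭.swap W V ↭.refl)

  sort-↭ : ∀ Vs → value (sort Vs) ↭ Vs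
  sort-↭ []       = ↭.refl
  sort-↭ (V ∷ Vs) = ↭.trans (insert-↭ V _) (↭.prep V (sort-↭ Vs))

  insert-sorted : ∀ V {Ws} → Sorted Ws → Sorted (value (insert V Ws))
  insert-sorted V [] = [] ∷ []
  insert-sorted V {W ∷ Ws} (W≤Ws ∷ sorted) with o V ≤? o W
  ... | yes V≤W = (V≤W ∷ All.map (≤.trans V≤W) W≤Ws) ∷ W≤Ws ∷ sorted
    where open OrderedFieldProperties F
  ... | no  V≰W =
    -- `W` precedes `V` and all of `Ws`, hence everything in the result of the insertion, a
    -- permutation of `V ∷ Ws`.
    All-resp-↭ (↭-sym (insert-↭ V Ws)) (W≤V ∷ W≤Ws) ∷ insert-sorted V sorted
    where
    open OrderedFieldProperties F
    W≤V : o W ≤ o V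
    W≤V with ≤.total (o V) (o W)
    ... | inj₁ V≤W = contradiction V≤W V≰W
    ... | inj₂ W≤V = W≤V

  sort-sorted : ∀ Vs → Sorted (value (sort Vs))
  sort-sorted []       = []
  sort-sorted (V ∷ Vs) = insert-sorted V (sort-sorted Vs)

-- Power along a sequence of rides.

module Flight {c ℓ₁ ℓ₂} (F : OrderedField c ℓ₁ ℓ₂) (I : Hitching.Problem F) where
  open OrderedField F
  open OrderedFieldProperties F
  open IntegerSolver commutativeRing
  open Hitching F hiding (rides)
  open Problem I
  open Model I
  open ≤-Reasoning hiding (start)

  -- With `P` arbitrary this describes both a step of a feasible sequence and, when `P` is a node
  -- weight, a member of `Φ`.
  Compatible : Carrier → Ride → Ride → Set _
  Compatible P V V′ =
    t V + travel V + ∣ o V′ - d V ∣ / v₀ ≤ t V′ × 0# ≤ PTF P V V′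

  0≤v₀⁻¹ : 0# ≤ v₀ ⁻¹
  0≤v₀⁻¹ = 0≤x⁻¹ 0<v₀

  0≤α⁻¹ : 0# ≤ α ⁻¹
  0≤α⁻¹ = 0≤x⁻¹ 0<α

  0≤β : 0# ≤ β
  0≤β = ≤.trans (proj₁ 0<α) (proj₁ α<β)

  αα⁻¹≈1 : α * α ⁻¹ ≈ 1#
  αα⁻¹≈1 = ⁻¹-inverseʳ (<⇒≉0 0<α)

  0≤travel : ∀ {V} → IsRide a V → 0# ≤ travel V
  0≤travel V-ride = 0≤x/y (x≤y⇒0≤y-x (proj₁ o<d)) 0<v
    where open IsRide V-ride

  PTF-mono : ∀ {P Q} V V′ → P ≤ Q → PTF P V V′ ≤ PTF Q V V′
  PTF-mono V V′ P≤Q = +-monoˡ-≤ _ (+-monoˡ-≤ _ P≤Q)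

  Compatible-mono : ∀ {P Q V V′} → P ≤ Q → Compatible P V V′ → Compatible Q V V′
  Compatible-mono {V = V} {V′} P≤Q (inTime , powered) =
    inTime , ≤.trans powered (PTF-mono V V′ P≤Q)

  -- Departure times are fixed, so power enters only through the tests that it be nonnegative, and
  -- `PTF` is monotone in it. For powers equal up to `≈` this also serves as transport.
  FeasibleFrom-mono : ∀ {P Q V U} → P ≤ Q → FeasibleFrom P V U → FeasibleFrom Q V U
  FeasibleFrom-mono P≤Q end = end
  FeasibleFrom-mono {V = V} P≤Q (next {V′ = V′} inTime powered feasible) =
    next inTime (≤.trans powered PTF≤) (FeasibleFrom-mono PTF≤ feasible)
    where PTF≤ = PTF-mono V V′ P≤Q

  -- Charging adds up over time and consumption over the distance flown, so transfers telescope.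
  -- With `z` and `g` free this covers one further ride as well as a whole tail.
  PTF-extend : ∀ P V V′ z g →
    PTF P V V′ + (z - t V′) * α - (g * β) / v₀
    ≈ P + (z - t V) * α - ((∣ o V′ - d V ∣ + g) * β) / v₀
  PTF-extend P V V′ z g = solve 9
    (λ P x y z α h g β u →
      P :+ (y :- x) :* α :- (h :* β) :* u :+ (z :- y) :* α :- (g :* β) :* u
      := P :+ (z :- x) :* α :- ((h :+ g) :* β) :* u)
    refl P (t V) (t V′) z α ∣ o V′ - d V ∣ g β (v₀ ⁻¹)

  module Skip {P : Carrier} {V V′ W : Ride} (V′-ride : IsRide a V′) (W≤V′ : o W ≤ o V′) where
    open IsRide V′-ride

    g₁ = ∣ o V′ - d V ∣
    g₂ = ∣ o W - d V′ ∣

    -- Both signs of the distance are bounded. Forwards, `o W ≤ o V′` makes `g₁` alone enough.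
    -- Backwards, the length `d V′ - o V′` is nonnegative slack, and adding it splits the distance
    -- into the two reversed gaps.
    skip-gap : ∣ o W - d V ∣ ≤ g₁ + g₂
    skip-gap = ⊔.⊔-lub
      (begin
        o W - d V   ≤⟨ +-monoˡ-≤ _ W≤V′ ⟩
        o V′ - d V  ≤⟨ x≤∣x∣ _ ⟩
        g₁          ≤⟨ x≤x+y (0≤∣x∣ _) ⟩
        g₁ + g₂     ∎)
      (begin
        - (o W - d V)                      ≤⟨ x≤x+y (x≤y⇒0≤y-x (proj₁ o<d)) ⟩
        - (o W - d V) + (d V′ - o V′)      ≈⟨ solve 4 (λ x y z w →
          :- (x :- y) :+ (z :- w) := :- (w :- y) :+ :- (x :- z)) refl _ _ _ _ ⟩
        - (o V′ - d V) + - (o W - d V′)    ≤⟨ +-mono-≤ (-x≤∣x∣ _) (-x≤∣x∣ _) ⟩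
        g₁ + g₂                            ∎)

    -- The departures of `V` and `W` are the same on both sides, so the charge agrees and only the
    -- distance flown differs.
    skip-PTF : PTF (PTF P V V′) V′ W ≤ PTF P V W
    skip-PTF = begin
      PTF (PTF P V V′) V′ W
        ≈⟨ PTF-extend P V V′ (t W) g₂ ⟩
      P + (t W - t V) * α - ((g₁ + g₂) * β) / v₀
        ≤⟨ +-monoʳ-≤ _ (neg-antimono-≤ (*-monoˡ-≤ 0≤v₀⁻¹ (*-monoˡ-≤ 0≤β skip-gap))) ⟩
      PTF P V W ∎

    skip-compatible : Compatible P V V′ → Compatible (PTF P V V′) V′ W → Compatible P V W
    skip-compatible (inTime , _) (inTime′ , powered′) =
      (begin
        t V + travel V + ∣ o W - d V ∣ / v₀
          ≤⟨ +-monoʳ-≤ _ (*-monoˡ-≤ 0≤v₀⁻¹ skip-gap) ⟩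
        t V + travel V + (g₁ + g₂) / v₀
          ≈⟨ solve 4 (λ x g₁ g₂ u → x :+ (g₁ :+ g₂) :* u := x :+ g₁ :* u :+ g₂ :* u)
               refl _ g₁ g₂ (v₀ ⁻¹) ⟩
        t V + travel V + g₁ / v₀ + g₂ / v₀
          -- The nonnegative time aboard `V′`, saved by skipping, is inserted here to match
          -- `inTime′`.
          ≤⟨ +-monoˡ-≤ _ (≤.trans inTime (x≤x+y (0≤travel V′-ride))) ⟩
        t V′ + travel V′ + g₂ / v₀
          ≤⟨ inTime′ ⟩
        t W ∎) ,
      ≤.trans powered′ skip-PTF

  travel-V₀ : travel V₀ ≈ 0#
  travel-V₀ = trans (*-congʳ (-‿inverseʳ 0#)) (zeroˡ _)

  module _ {V} (V-ride : IsRide a V) where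
    open IsRide V-ride

    gap-V₀ : ∣ o V - 0# ∣ ≈ o V
    gap-V₀ = trans (∣∣-cong (solve 1 (λ x → x :- con (ℤ.+ 0) := x) refl (o V))) (0≤x⇒∣x∣≈x 0≤o)

    inTime-V₀ : t V₀ + travel V₀ + ∣ o V - d V₀ ∣ / v₀ ≈ o V / v₀
    inTime-V₀ = trans
      (+-cong (trans (+-identityˡ _) travel-V₀) (*-congʳ gap-V₀)) (+-identityˡ _)

    PTF-V₀ : PTF P₀ V₀ V ≈ P₁ V
    PTF-V₀ = trans
      (+-congˡ (-‿cong (*-congʳ (*-congʳ gap-V₀))))
      (solve 6 (λ P t α o β u → P :+ (t :- con (ℤ.+ 0)) :* α :- (o :* β) :* u
                             := P :+ t :* α :- (o :* u) :* β)
        refl P₀ (t V) α (o V) β (v₀ ⁻¹))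

    -- Treating takeoff as leaving `V₀` at time `0#` with power `P₀` puts the first ride on the same
    -- footing as the others; by `0≤o` its gap is `o V`.
    start⇒next : ∀ {U} → Feasible (V ∷ U) → FeasibleFrom P₀ V₀ (V ∷ U)
    start⇒next (start inTime powered feasible) = next
      (≤.≤-respˡ-≈ (sym inTime-V₀) inTime)
      (≤.≤-respʳ-≈ (sym PTF-V₀) powered)
      (FeasibleFrom-mono (≤.reflexive (sym PTF-V₀)) feasible)

    next⇒start : ∀ {U} → FeasibleFrom P₀ V₀ (V ∷ U) → Feasible (V ∷ U)
    next⇒start (next inTime powered feasible) = start
      (≤.≤-respˡ-≈ inTime-V₀ inTime)
      (≤.≤-respʳ-≈ PTF-V₀ powered)
      (FeasibleFrom-mono (≤.reflexive PTF-V₀) feasible)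

  powerAfter : Carrier → Ride → List Ride → Carrier
  powerAfter P V []       = P
  powerAfter P V (V′ ∷ U) = powerAfter (PTF P V V′) V′ U

  -- Departure times telescope and gaps add up. This links the power tracked ride by ride to the
  -- total distance in `ξ`.
  powerAfter-gaps : ∀ P V U →
    powerAfter P V U ≈ P + (t (lastRide V U) - t V) * α - (gaps V U * β) / v₀
  powerAfter-gaps P V [] =
    solve 5 (λ P t α β u → P := P :+ (t :- t) :* α :- (con (ℤ.+ 0) :* β) :* u)
      refl P (t V) α β (v₀ ⁻¹)
  powerAfter-gaps P V (V′ ∷ U) = begin-equality
    powerAfter (PTF P V V′) V′ U
      ≈⟨ powerAfter-gaps (PTF P V V′) V′ U ⟩
    PTF P V V′ + (t (lastRide V′ U) - t V′) * α - (gaps V′ U * β) / v₀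
      ≈⟨ PTF-extend P V V′ (t (lastRide V′ U)) (gaps V′ U) ⟩
    P + (t (lastRide V′ U) - t V) * α - (gaps V (V′ ∷ U) * β) / v₀ ∎

  -- Arrival times.

  toGo : Ride → Carrier
  toGo V = (a - d V) / v₀

  -- The first term is when the power for the final flight has been collected.
  arrival : Carrier → Ride → Carrier
  arrival P V = max (t V + (toGo V * β - P) / α) (t V + travel V + toGo V)

  arrival-antitone : ∀ {P Q} V → P ≤ Q → arrival Q V ≤ arrival P V
  arrival-antitone V P≤Q = ⊔.⊔-monoˡ-≤ _
    (+-monoʳ-≤ _ (*-monoˡ-≤ 0≤α⁻¹ (+-monoʳ-≤ _ (neg-antimono-≤ P≤Q))))

  -- The left side is the value of `sinkWeight`. Since `α ⁻¹` is nonnegative, sum and factor move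
  -- inside the maximum; in its first term the time aboard and the final flight time cancel against
  -- the charging during them.
  arrival-sink : ∀ P V →
    t V + travel V + toGo V
      + (1# / α) * max (toGo V * (β - α) - (P + α * travel V)) 0#
    ≈ arrival P V
  arrival-sink P V = begin-equality
    s + (1# / α) * max x 0#               ≈⟨ +-congˡ (*-congʳ (*-identityˡ _)) ⟩
    s + α ⁻¹ * max x 0#                   ≈⟨ max-homo 0≤α⁻¹ x 0# ⟩
    max (s + α ⁻¹ * x) (s + α ⁻¹ * 0#)    ≈⟨ ⊔.⊔-cong charging waiting ⟩
    arrival P V                           ∎
    where
    T = travel V
    g = toGo V
    s = t V + T + g
    x = g * (β - α) - (P + α * T)

    charging : s + α ⁻¹ * x ≈ t V + (g * β - P) / α
    charging = begin-equality
      s + α ⁻¹ * x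
        -- The solver treats `α ⁻¹` as a variable, so `α * α ⁻¹` is isolated for the next step to
        -- replace by `1#`.
        ≈⟨ solve 7 (λ t T g β α P j →
             t :+ T :+ g :+ j :* (g :* (β :- α) :- (P :+ α :* T))
             := t :+ T :+ g :+ (g :* β :- P) :* j :- (T :+ g) :* (α :* j))
             refl (t V) T g β α P (α ⁻¹) ⟩
      s + (g * β - P) / α - (T + g) * (α * α ⁻¹)
        ≈⟨ +-congˡ (-‿cong (trans (*-congˡ αα⁻¹≈1) (*-identityʳ _))) ⟩
      s + (g * β - P) / α - (T + g)
        ≈⟨ solve 4 (λ t T g z → t :+ T :+ g :+ z :- (T :+ g) := t :+ z)
             refl (t V) T g _ ⟩
      t V + (g * β - P) / α ∎

    waiting : s + α ⁻¹ * 0# ≈ s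
    waiting = trans (+-congˡ (zeroʳ _)) (+-identityʳ s)

  -- By `P₀<need`, collecting the power for a direct flight takes at least as long as the flight, so
  -- the maximum in `arrival` is its first term.
  ξ-arrival-[] : ξ [] ≈ arrival P₀ V₀
  ξ-arrival-[] = begin-equality
    ξ []          ≈⟨ charging ⟩
    x             ≈⟨ ⊔.x≤y⇒y⊔x≈y waiting≤charging ⟨
    arrival P₀ V₀ ∎
    where
    x = 0# + (toGo V₀ * β - P₀) / α

    charging : ξ [] ≈ x
    charging = solve 5 (λ a P β j u →
      (β :* j) :* (a :* u) :- P :* j
      := con (ℤ.+ 0) :+ (((a :- con (ℤ.+ 0)) :* u) :* β :- P) :* j)
      refl a P₀ β (α ⁻¹) (v₀ ⁻¹)

    waiting≤charging : 0# + travel V₀ + toGo V₀ ≤ x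
    waiting≤charging = begin
      0# + travel V₀ + toGo V₀
        ≈⟨ +-congʳ (trans (+-identityˡ _) travel-V₀) ⟩
      0# + toGo V₀
        ≈⟨ +-congˡ (trans (*-congˡ αα⁻¹≈1) (*-identityʳ _)) ⟨
      0# + toGo V₀ * (α * α ⁻¹)
        ≤⟨ x≤x+y (*-nonNeg (x≤y⇒0≤y-x (proj₁ P₀<need)) 0≤α⁻¹) ⟩
      0# + toGo V₀ * (α * α ⁻¹) + (((β - α) * a) / v₀ - P₀) / α
        ≈⟨ solve 6 (λ a P β α j u →
             con (ℤ.+ 0) :+ ((a :- con (ℤ.+ 0)) :* u) :* (α :* j)
               :+ (((β :- α) :* a) :* u :- P) :* j
             := con (ℤ.+ 0) :+ (((a :- con (ℤ.+ 0)) :* u) :* β :- P) :* j)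
             refl a P₀ β α (α ⁻¹) (v₀ ⁻¹) ⟩
      x ∎

  -- The second terms coincide. In the first, `ξ` counts the charging time for all flights,
  -- `arrival` only what is missing at the last departure; the charge collected until then accounts
  -- for `t L`.
  ξ-arrival-∷ : ∀ {V} U → IsRide a V →
    ξ (V ∷ U) ≈ arrival (powerAfter P₀ V₀ (V ∷ U)) (lastRide V U)
  ξ-arrival-∷ {V} U V-ride = ⊔.⊔-congʳ _ (begin-equality
    (o V + g + (a - d L)) * (β / (α * v₀)) - P₀ / α
      ≈⟨ +-congʳ (*-congˡ (*-congˡ (⁻¹-distrib-* 0<α 0<v₀))) ⟩
    (o V + g + (a - d L)) * (β * (α ⁻¹ * v₀ ⁻¹)) - P₀ / α
      -- `T` is added and subtracted so that the subtracted copy can become the charge `T * α` under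
      -- the division by `α`.
      ≈⟨ solve 8 (λ o g D β j u P T →
           (o :+ g :+ D) :* (β :* (j :* u)) :- P :* j
           := T :+ (D :* u :* β :- P :+ ((o :+ g) :* β) :* u) :* j :- T)
           refl (o V) g (a - d L) β (α ⁻¹) (v₀ ⁻¹) P₀ (t L) ⟩
    t L + (toGo L * β - P₀ + ((o V + g) * β) / v₀) / α - t L
      ≈⟨ +-congˡ (-‿cong (trans (*-congˡ αα⁻¹≈1) (*-identityʳ _))) ⟨
    t L + (toGo L * β - P₀ + ((o V + g) * β) / v₀) / α - t L * (α * α ⁻¹)
      ≈⟨ solve 10 (λ o g h β j u P T α S →
           T :+ (h :* β :- P :+ ((o :+ g) :* β) :* u) :* j :- T :* (α :* j)
           := T :+ (h :* β :- (P :+ S :* α :- (o :* u) :* β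
                                 :+ (T :- S) :* α :- (g :* β) :* u)) :* j)
           refl (o V) g (toGo L) β (α ⁻¹) (v₀ ⁻¹) P₀ (t L) α (t V) ⟩
    t L + (toGo L * β - (P₁ V + (t L - t V) * α - (g * β) / v₀)) / α
      ≈⟨ +-congˡ (*-congʳ (+-congˡ (-‿cong power))) ⟨
    t L + (toGo L * β - powerAfter P₀ V₀ (V ∷ U)) / α ∎)
    where
    L = lastRide V U
    g = gaps V U

    power : powerAfter P₀ V₀ (V ∷ U) ≈ P₁ V + (t L - t V) * α - (g * β) / v₀
    power = trans (powerAfter-gaps _ V U) (+-congʳ (+-congʳ (PTF-V₀ V-ride)))

-- The graph represents all reachable states.

module Network {c ℓ₁ ℓ₂} (F : OrderedField c ℓ₁ ℓ₂)
               (I : Hitching.Problem F) (τ : Hitching.TieBreak F) where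
  open OrderedField F
  open OrderedFieldProperties F using (module ≤; module ≤-Reasoning)
  open Hitching F hiding (rides; IsOptimal)
  open Search F
  open Problem I
  open Model I
    using (PTF; FeasibleFrom; end; next; empty; lastRide; ξ; IsSolution; IsOptimal)
  open Flight F I
  open Algorithm I τ
  open TieBreak τ

  ptfTo : Ride → Node → Carrier
  ptfTo V M = PTF (weight M) (ride M) V

  Φ-complete : ∀ {V M Ms} → M ∈ Ms → Compatible (weight M) (ride M) V →
               (ptfTo V M , M) ∈ value (Φ V Ms)
  Φ-complete {V} {M} (here ≡.refl) (inTime , powered)
    with t (ride M) + travel (ride M) + ∣ o V - d (ride M) ∣ / v₀ ≤? t V
       | 0# ≤? ptfTo V M
  ... | yes _ | yes _ = here ≡.refl
  ... | no late | _ = contradiction inTime late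
  ... | yes _ | no dead = contradiction powered dead
  Φ-complete {V} {M} {M′ ∷ _} (there M∈Ms) c
    with t (ride M′) + travel (ride M′) + ∣ o V - d (ride M′) ∣ / v₀ ≤? t V
       | 0# ≤? ptfTo V M′
  ... | yes _ | yes _ = there (Φ-complete M∈Ms c)
  ... | yes _ | no _  = Φ-complete M∈Ms c
  ... | no _  | _     = Φ-complete M∈Ms c

  Φ-sound : ∀ {V p M} Ms → (p , M) ∈ value (Φ V Ms) →
            M ∈ Ms × p ≡ ptfTo V M × Compatible (weight M) (ride M) V
  Φ-sound {V} (M ∷ Ms) pM∈
    with t (ride M) + travel (ride M) + ∣ o V - d (ride M) ∣ / v₀ ≤? t V
       | 0# ≤? ptfTo V M
  Φ-sound (M ∷ Ms) (here ≡.refl) | yes inTime | yes powered =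
    here ≡.refl , ≡.refl , inTime , powered
  Φ-sound (M ∷ Ms) (there pM∈) | yes _ | yes _ =
    let M∈ , rest = Φ-sound Ms pM∈ in there M∈ , rest
  Φ-sound (M ∷ Ms) pM∈ | yes _ | no _ =
    let M∈ , rest = Φ-sound Ms pM∈ in there M∈ , rest
  Φ-sound (M ∷ Ms) pM∈ | no _ | _ =
    let M∈ , rest = Φ-sound Ms pM∈ in there M∈ , rest

  -- A specification of `addRide` that hides `Φ` and `argmax`; membership, soundness, length and
  -- depth are derived from it. It admits any maximal predecessor, so tie-breaking disappears here.
  data AddRide (V : Ride) (N : List⁺ Node) : List⁺ Node → Set (c ⊔ ℓ₂) where
    skipped : (∀ {M} → M ∈ toList N → ¬ Compatible (weight M) (ride M) V) →
              AddRide V N N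
    added   : ∀ {M} → M ∈ toList N → Compatible (weight M) (ride M) V →
              (∀ {M′} → M′ ∈ toList N → Compatible (weight M′) (ride M′) V →
                        ptfTo V M′ ≤ ptfTo V M) →
              AddRide V N (node V (ptfTo V M) M ∷⁺ N)

  addRide-correct : ∀ V N → AddRide V N (value (addRide V N))
  addRide-correct V N with value (Φ V (toList N)) in eq
  ... | [] = skipped λ M∈N c → case (≡.subst (_ ∈_) eq (Φ-complete M∈N c)) of λ ()
  ... | pM ∷ others
    with value (argmax (preferPred V) pM others)
       | ArgMax.select-extremal (preferPred V) pM others
  ...   | p , M | pM∈ , maximal
    with Φ-sound {p = p} {M} (toList N) (≡.subst ((p , M) ∈_) (≡.sym eq) pM∈)
  ...     | M∈N , ≡.refl , c = added M∈N c λ M′∈N c′ →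
    All.lookup maximal (≡.subst (_ ∈_) eq (Φ-complete M′∈N c′))

  addRide-⊇ : ∀ {V N N′ M} → AddRide V N N′ → M ∈ toList N → M ∈ toList N′
  addRide-⊇ (skipped _)   M∈N = M∈N
  addRide-⊇ (added _ _ _) M∈N = there M∈N

  addRide-new : ∀ {V N N′ M} → AddRide V N N′ → M ∈ toList N′ →
                M ∈ toList N ⊎ ride M ≡ V
  addRide-new (skipped _)   M∈N           = inj₁ M∈N
  addRide-new (added _ _ _) (here ≡.refl) = inj₂ ≡.refl
  addRide-new (added _ _ _) (there M∈N)   = inj₁ M∈N

  -- Dominance rather than equality: a node keeps only the best power found for its ride.
  Represented : List⁺ Node → Carrier → Ride → Set _
  Represented N P V = ∃ λ M → M ∈ toList N × ride M ≡ V × P ≤ weight M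

  addRide-represents : ∀ {V N N′ M} → AddRide V N N′ → M ∈ toList N →
                       Compatible (weight M) (ride M) V →
                       Represented N′ (ptfTo V M) V
  addRide-represents (skipped none)      M∈N c = contradiction c (none M∈N)
  addRide-represents (added _ _ maximal) M∈N c = _ , here ≡.refl , ≡.refl , maximal M∈N c

  addRides-⊇ : ∀ {M} Vs N → M ∈ toList N → M ∈ toList (value (addRides Vs N))
  addRides-⊇ []       N M∈N = M∈N
  addRides-⊇ (V ∷ Vs) N M∈N = addRides-⊇ Vs _ (addRide-⊇ (addRide-correct V N) M∈N)

  addRides-new : ∀ {M} Vs N → M ∈ toList (value (addRides Vs N)) →
                 M ∈ toList N ⊎ ride M ∈ Vs
  addRides-new []       N M∈N = inj₁ M∈N
  addRides-new (V ∷ Vs) N M∈N′ with addRides-new Vs _ M∈N′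
  ... | inj₂ M∈Vs = inj₂ (there M∈Vs)
  ... | inj₁ M∈N₁ with addRide-new (addRide-correct V N) M∈N₁
  ...   | inj₁ M∈N = inj₁ M∈N
  ...   | inj₂ M≡V = inj₂ (here M≡V)

  -- The point is that `M`, found in the final graph, was present when `V` was processed. From `V`
  -- on, only rides starting at `o V` or beyond are added, so a node starting strictly before `V` is
  -- already in `N`. The first alternative is for the origin, which may share its start location
  -- with `V`.
  addRides-represents :
    ∀ {M V} Vs N → Sorted Vs → V ∈ Vs →
    M ∈ toList (value (addRides Vs N)) → M ∈ toList N ⊎ ¬ (o V ≤ o (ride M)) →
    Compatible (weight M) (ride M) V →
    Represented (value (addRides Vs N)) (ptfTo V M) V
  addRides-represents {M} (V ∷ Vs) N (V≤Vs ∷ _) (here ≡.refl) M∈N′ early c =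
    let M′ , M′∈N₁ , rest = addRide-represents (addRide-correct V N) M∈N c
    in  M′ , addRides-⊇ Vs _ M′∈N₁ , rest
    where
    later⇒∈N : ¬ (o V ≤ o (ride M)) → M ∈ toList N
    later⇒∈N V≰M with addRides-new Vs _ M∈N′
    ... | inj₂ M∈Vs = contradiction (All.lookup V≤Vs M∈Vs) V≰M
    ... | inj₁ M∈N₁ with addRide-new (addRide-correct V N) M∈N₁
    ...   | inj₁ M∈N    = M∈N
    ...   | inj₂ ≡.refl = contradiction ≤.refl V≰M

    M∈N : M ∈ toList N
    M∈N = Sum.[ id , later⇒∈N ]′ early

  addRides-represents (V ∷ Vs) N (_ ∷ sorted) (there V∈Vs) M∈N′ early c =
    addRides-represents Vs _ sorted V∈Vs M∈N′ early′ c
    where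
    early′ = Sum.map₁ (addRide-⊇ (addRide-correct V N)) early

  -- This describes the chain of predecessors alone, without the graph, so that `traceBack` can be
  -- verified by recursion on it.
  data Sound : Node → Set (c ⊔ ℓ₂) where
    origin : Sound origin
    node   : ∀ {V M} → V ∈ rides → Compatible (weight M) (ride M) V → Sound M →
             Sound (node V (ptfTo V M) M)

  addRides-sound : ∀ Vs N → Vs ⊆ rides → All Sound (toList N) →
                   All Sound (toList (value (addRides Vs N)))
  addRides-sound []       N ⊆rides sound = sound
  addRides-sound (V ∷ Vs) N ⊆rides sound =
    addRides-sound Vs _ (⊆rides ∘ there) (step (addRide-correct V N))
    where
    step : ∀ {N′} → AddRide V N N′ → All Sound (toList N′)
    step (skipped _)     = sound
    step (added M∈N c _) = node (⊆rides (here ≡.refl)) c (All.lookup sound M∈N) ∷ sound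

  -- The accumulator `U` holds the rides already traced, feasible from the current node; each step
  -- back prepends a ride by `next`. At the origin the sequence is complete, and its first ride
  -- turns from `next` into `start`.
  trace-correct :
    ∀ {M U} → Sound M → FeasibleFrom (weight M) (ride M) U → All (_∈ rides) U →
    IsSolution (value (traceBack M U)) ×
    ξ (value (traceBack M U)) ≈ arrival (powerAfter (weight M) (ride M) U) (lastRide (ride M) U)
  trace-correct {U = []} origin _ _ = ((λ ()) , empty) , ξ-arrival-[]
  trace-correct {U = V ∷ U} origin feasible U∈rides@(V∈rides ∷ _) =
    (All.lookup U∈rides , next⇒start V-ride feasible) , ξ-arrival-∷ U V-ride
    where V-ride = All.lookup areRides V∈rides
  trace-correct (node V∈rides (inTime , powered) sound) feasible U∈rides =
    trace-correct sound (next inTime powered feasible) (V∈rides ∷ U∈rides)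

  sinkEdges-map : ∀ Ms → value (sinkEdges Ms) ≡ map (λ M → value (sinkWeight M) , M) Ms
  sinkEdges-map []       = ≡.refl
  sinkEdges-map (M ∷ Ms) = ≡.cong (_ ∷_) (sinkEdges-map Ms)

  -- States attainable by rides in any order of start locations. Rides are appended at the end,
  -- unlike in `FeasibleFrom`, so that `board-represented` can remove the last one and recurse on
  -- the state before it.
  data Reach : Carrier → Ride → Set (c ⊔ ℓ₂) where
    origin : Reach P₀ V₀
    board  : ∀ {P V V′} → Reach P V → V′ ∈ rides → Compatible P V V′ →
             Reach (PTF P V V′) V′

  reach-after : ∀ {P V U} → Reach P V → FeasibleFrom P V U → All (_∈ rides) U →
                Reach (powerAfter P V U) (lastRide V U)
  reach-after R end [] = R
  reach-after R (next inTime powered feasible) (V∈rides ∷ U∈rides) =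
    reach-after (board R V∈rides (inTime , powered)) feasible U∈rides

  sorted : List Ride
  sorted = value (sort rides)

  nodes : List⁺ Node
  nodes = value (addRides sorted [ origin ])

  -- The extra power of the dominating node keeps the ride compatible and only raises the power
  -- transferred.
  nodes-represent : ∀ {M P V} → M ∈ toList nodes → P ≤ weight M → V ∈ rides →
                    M ∈ origin ∷ [] ⊎ ¬ (o V ≤ o (ride M)) →
                    Compatible P (ride M) V → Represented nodes (PTF P (ride M) V) V
  nodes-represent {M} {V = V} M∈nodes P≤w V∈rides early compatible =
    let M′ , M′∈nodes , M′≡V , ptf≤w = addRides-represents sorted [ origin ]
          (sort-sorted rides) (∈-resp-↭ (↭-sym (sort-↭ rides)) V∈rides)
          M∈nodes early (Compatible-mono {V = ride M} {V} P≤w compatible)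
    in  M′ , M′∈nodes , M′≡V , ≤.trans (PTF-mono (ride M) V P≤w) ptf≤w

  origin∈nodes : origin ∈ toList nodes
  origin∈nodes = addRides-⊇ sorted [ origin ] (here ≡.refl)

  -- If the last ride boarded does not start before the new one it can be skipped;
  -- otherwise it precedes the new one in the order in which the nodes are added.
  board-represented : ∀ {P V V′} → Reach P V → V′ ∈ rides → Compatible P V V′ →
                      Represented nodes (PTF P V V′) V′
  board-represented origin V′∈rides compatible =
    nodes-represent origin∈nodes ≤.refl V′∈rides (inj₁ (here ≡.refl)) compatible
  board-represented {V′ = W} (board {P} {V} {V′} R V′∈rides compatible) W∈rides compatible′
    with o W ≤? o V′
  ... | yes W≤V′ =
    let M , M∈nodes , M≡W , ptf≤w =
          board-represented R W∈rides (skip-compatible compatible compatible′)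
    in  M , M∈nodes , M≡W , ≤.trans skip-PTF ptf≤w
    where open Skip {P} {V} {V′} {W} (All.lookup areRides V′∈rides) W≤V′
  ... | no W≰V′ with board-represented R V′∈rides compatible
  ...   | M , M∈nodes , ≡.refl , ptf≤w =
    nodes-represent M∈nodes ptf≤w W∈rides (inj₂ W≰V′) compatible′

  reach-represented : ∀ {P V} → Reach P V → Represented nodes P V
  reach-represented origin = origin , origin∈nodes , ≡.refl , ≤.refl
  reach-represented (board R V∈rides compatible) = board-represented R V∈rides compatible

  solution-reach : ∀ {U} → IsSolution U →
                   ∃₂ λ P V → Reach P V × ξ U ≈ arrival P V
  solution-reach {[]} _ = P₀ , V₀ , origin , ξ-arrival-[]
  solution-reach {V ∷ U} (⊆rides , feasible) =
    _ , _ ,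
    reach-after origin (start⇒next V-ride feasible) (All.tabulate ⊆rides) ,
    ξ-arrival-∷ U V-ride
    where V-ride = All.lookup areRides (⊆rides (here ≡.refl))

  -- Optimality of the output.

  keyed : Node → Keyed
  keyed M = value (sinkWeight M) , M

  bestKeyed : Keyed
  bestKeyed = value (argmin preferLast (keyed (head nodes)) (value (sinkEdges (tail nodes))))

  best : Node
  best = proj₂ bestKeyed

  -- In the flipped order extremal means minimal; `sinkEdges-map` turns the computed edges into a
  -- plain `map`.
  best-extremal : ArgMin.Extremal preferLast bestKeyed (map keyed (toList nodes))
  best-extremal = ≡.subst
    (λ kMs → ArgMin.Extremal preferLast bestKeyed (keyed (head nodes) ∷ kMs))
    (sinkEdges-map (tail nodes)) (ArgMin.select-extremal preferLast _ _)

  ∈-keyed : ∀ {kM Ms} → kM ∈ map keyed Ms → kM ≡ keyed (proj₂ kM) × proj₂ kM ∈ Ms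
  ∈-keyed kM∈ with ∈-map⁻ keyed kM∈
  ... | _ , M∈Ms , ≡.refl = ≡.refl , M∈Ms

  best∈nodes : bestKeyed ≡ keyed best × best ∈ toList nodes
  best∈nodes = ∈-keyed (proj₁ best-extremal)

  best-arrival : ∀ {M} → M ∈ toList nodes →
                 arrival (weight best) (ride best) ≤ arrival (weight M) (ride M)
  best-arrival {M} M∈nodes = begin
    arrival (weight best) (ride best)  ≈⟨ arrival-sink (weight best) (ride best) ⟨
    value (sinkWeight best)            ≡⟨ ≡.cong proj₁ (proj₁ best∈nodes) ⟨
    proj₁ bestKeyed                    ≤⟨ All.lookup (proj₂ best-extremal) (∈-map⁺ keyed M∈nodes) ⟩
    value (sinkWeight M)               ≈⟨ arrival-sink (weight M) (ride M) ⟩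
    arrival (weight M) (ride M)        ∎
    where open ≤-Reasoning

  -- By `trace-correct` the output arrives when `best` does. The final state of any solution is
  -- dominated by a node, and `best` arrives no later than that node.
  optimal : IsOptimal (value (OptimalHitching I τ))
  optimal = proj₁ output , minimal
    where
    open ≤-Reasoning

    output = trace-correct
      (All.lookup (addRides-sound sorted [ origin ] (∈-resp-↭ (sort-↭ rides)) (origin ∷ []))
                  (proj₂ best∈nodes))
      end []

    minimal : ∀ U → IsSolution U → ξ (value (traceBack best [])) ≤ ξ U
    minimal U solution with solution-reach solution
    ... | P , V , R , ξ≈ with reach-represented R
    ...   | M , M∈nodes , ≡.refl , P≤w = begin
      ξ (value (traceBack best []))      ≈⟨ proj₂ output ⟩
      arrival (weight best) (ride best)  ≤⟨ best-arrival M∈nodes ⟩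
      arrival (weight M) (ride M)        ≤⟨ arrival-antitone (ride M) P≤w ⟩
      arrival P (ride M)                 ≈⟨ ξ≈ ⟨
      ξ U                                ∎

-- Running time: the quadratic bound.

module NatArithmetic where
  open import Data.Nat.Base public using (_+_; _*_; _≤_; _<_; z≤n; s≤s; s≤s⁻¹)
  open import Data.Nat.Properties public
    using ( module ≤-Reasoning; ≤-refl; ≤-reflexive; ≤-trans; <⇒≤
          ; n≤1+n; m≤n⇒m≤1+n; m≤m+n; m≤n+m
          ; +-comm; +-identityʳ; +-suc; +-mono-≤; +-monoʳ-≤; *-monoʳ-≤ )

  -- `102` is the sum of the coefficients, as `n` and `1` are at most `n * n` when `1 ≤ n`.
  quadratic-bound : ∀ {n} → 1 ≤ n → 24 * (n * n) + 54 * n + 24 ≤ 102 * n ^ 2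
  quadratic-bound {suc k} _ = begin
    -- The added summand is the exact difference of the two sides.
    24 * (suc k * suc k) + 54 * suc k + 24                              ≤⟨ m≤m+n _ _ ⟩
    24 * (suc k * suc k) + 54 * suc k + 24 + (78 * (k * k) + 102 * k)   ≡⟨ arith k ⟩
    102 * (suc k * (suc k * 1))                                         ∎
    where
    open ≤-Reasoning
    arith : ∀ k → 24 * (suc k * suc k) + 54 * suc k + 24 + (78 * (k * k) + 102 * k)
                  ≡ 102 * (suc k * (suc k * 1))
    arith = solve-∀

-- Running time: sorting and tracing back.

module SearchCost {c ℓ₁ ℓ₂} (F : OrderedField c ℓ₁ ℓ₂) where
  open NatArithmetic
  open OrderedField F using (_≤?_)
  open Hitching F
  open Search F
  open ≤-Reasoning

  cost-insert : ∀ V Ws → cost (insert V Ws) ≤ 2 + 2 * length Ws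
  cost-insert V [] = s≤s z≤n
  cost-insert V (W ∷ Ws) with o V ≤? o W
  ... | yes _ = s≤s (s≤s z≤n)
  ... | no _  = begin
    2 + (cost (insert V Ws) + 0)   ≡⟨ ≡.cong (2 +_) (+-identityʳ _) ⟩
    2 + cost (insert V Ws)         ≤⟨ +-monoʳ-≤ 2 (cost-insert V Ws) ⟩
    2 + (2 + 2 * length Ws)        ≡⟨ arith (length Ws) ⟩
    2 + 2 * length (W ∷ Ws)        ∎
    where
    arith : ∀ n → 2 + (2 + 2 * n) ≡ 2 + 2 * suc n
    arith = solve-∀

  length-sort : ∀ Vs → length (value (sort Vs)) ≡ length Vs
  length-sort Vs = ↭-length (sort-↭ Vs)

  -- The bound `n` stays fixed while the list shrinks, so each ride is charged the same: one call
  -- and at most `2 + 2 * n` for its insertion.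
  cost-sort : ∀ {n} Vs → length Vs ≤ n → cost (sort Vs) ≤ 1 + length Vs * (3 + 2 * n)
  cost-sort [] _ = s≤s z≤n
  cost-sort {n} (V ∷ Vs) Vs<n = begin
    1 + (cost (sort Vs) + cost (insert V (value (sort Vs))))
      ≤⟨ +-monoʳ-≤ 1 (+-mono-≤ (cost-sort Vs (<⇒≤ Vs<n)) (cost-insert V (value (sort Vs)))) ⟩
    1 + (1 + k * (3 + 2 * n) + (2 + 2 * length (value (sort Vs))))
      ≡⟨ ≡.cong (λ l → 1 + (1 + k * (3 + 2 * n) + (2 + 2 * l))) (length-sort Vs) ⟩
    1 + (1 + k * (3 + 2 * n) + (2 + 2 * k))
      ≤⟨ +-monoʳ-≤ 1 (+-monoʳ-≤ (1 + k * (3 + 2 * n)) (+-monoʳ-≤ 2 (*-monoʳ-≤ 2 (<⇒≤ Vs<n)))) ⟩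
    1 + (1 + k * (3 + 2 * n) + (2 + 2 * n))
      ≡⟨ arith k n ⟩
    1 + suc k * (3 + 2 * n) ∎
    where
    k = length Vs
    arith : ∀ k n → 1 + (1 + k * (3 + 2 * n) + (2 + 2 * n)) ≡ 1 + suc k * (3 + 2 * n)
    arith = solve-∀

  depth : Node → ℕ
  depth origin       = 0
  depth (node _ _ M) = suc (depth M)

  cost-traceBack : ∀ M U → cost (traceBack M U) ≡ suc (depth M)
  cost-traceBack origin       U = ≡.refl
  cost-traceBack (node V _ M) U = ≡.cong suc (cost-traceBack M (V ∷ U))

-- Running time: building and evaluating the graph.

module NetworkCost {c ℓ₁ ℓ₂} (F : OrderedField c ℓ₁ ℓ₂)
                   (I : Hitching.Problem F) (τ : Hitching.TieBreak F) where
  open NatArithmetic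
  open Hitching F hiding (rides)
  open Search F
  open SearchCost F
  open Network F I τ
  open Problem I using (rides; v₀)
  private module F = OrderedField F
  open Algorithm I τ
  open TieBreak τ
  open ≤-Reasoning

  -- 18 = 8 (ptf) + 8 (inTime) + 1 (powered) + 1 (recursion)
  cost-Φ : ∀ V Ms → cost (Φ V Ms) ≡ 1 + 18 * length Ms
  cost-Φ V []       = ≡.refl
  cost-Φ V (M ∷ Ms) = begin-equality
    18 + (cost (Φ V Ms) + 0)     ≡⟨ ≡.cong (18 +_) (+-identityʳ _) ⟩
    18 + cost (Φ V Ms)           ≡⟨ ≡.cong (18 +_) (cost-Φ V Ms) ⟩
    18 + (1 + 18 * length Ms)    ≡⟨ arith (length Ms) ⟩
    1 + 18 * length (M ∷ Ms)     ∎
    where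
    arith : ∀ n → 18 + (1 + 18 * n) ≡ 1 + 18 * suc n
    arith = solve-∀

  length-Φ : ∀ V Ms → length (value (Φ V Ms)) ≤ length Ms
  length-Φ V []       = z≤n
  length-Φ V (M ∷ Ms)
    with ⌊ t (ride M) F.+ travel (ride M) F.+ F.∣ o V F.- d (ride M) ∣ F./ v₀ F.≤? t V ⌋
         ∧ ⌊ F.0# F.≤? ptfTo V M ⌋
  ... | true  = s≤s (length-Φ V Ms)
  ... | false = m≤n⇒m≤1+n (length-Φ V Ms)

  -- Each node costs 18 in `Φ` and at most 4 in `argmax`; the 3 are this call and the base calls of
  -- `Φ` and `select`.
  cost-addRide : ∀ V N → cost (addRide V N) ≤ 3 + 22 * length (toList N)
  cost-addRide V N with value (Φ V (toList N)) | length-Φ V (toList N)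
  ... | [] | _ = begin
    1 + (cost (Φ V (toList N)) + 0)  ≡⟨ ≡.cong suc (+-identityʳ _) ⟩
    1 + cost (Φ V (toList N))        ≡⟨ ≡.cong suc (cost-Φ V (toList N)) ⟩
    2 + 18 * n                       ≤⟨ m≤m+n _ (1 + 4 * n) ⟩
    2 + 18 * n + (1 + 4 * n)         ≡⟨ arith n ⟩
    3 + 22 * n                       ∎
    where
    n = length (toList N)
    arith : ∀ n → 2 + 18 * n + (1 + 4 * n) ≡ 3 + 22 * n
    arith = solve-∀
  ... | pM ∷ others | others<n = begin
    1 + (cost (Φ V (toList N)) + (cost (argmax (preferPred V) pM others) + 0))
      ≡⟨ ≡.cong₂ (λ x y → 1 + (x + y)) (cost-Φ V (toList N))
           (≡.trans (+-identityʳ _) (ArgMax.cost-select (preferPred V) pM others)) ⟩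
    1 + (1 + 18 * n + (1 + 4 * length others))
      ≤⟨ +-monoʳ-≤ 1 (+-monoʳ-≤ (1 + 18 * n) (+-monoʳ-≤ 1 (*-monoʳ-≤ 4 (<⇒≤ others<n)))) ⟩
    1 + (1 + 18 * n + (1 + 4 * n))
      ≡⟨ arith n ⟩
    3 + 22 * n ∎
    where
    n = length (toList N)
    arith : ∀ n → 1 + (1 + 18 * n + (1 + 4 * n)) ≡ 3 + 22 * n
    arith = solve-∀

  length-addRide : ∀ {V N N′} → AddRide V N N′ → length (toList N′) ≤ suc (length (toList N))
  length-addRide (skipped _)   = n≤1+n _
  length-addRide (added _ _ _) = ≤-refl

  length-addRides : ∀ Vs N →
    length (toList (value (addRides Vs N))) ≤ length Vs + length (toList N)
  length-addRides []       N = ≤-refl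
  length-addRides (V ∷ Vs) N = begin
    length (toList (value (addRides Vs N′)))  ≤⟨ length-addRides Vs N′ ⟩
    length Vs + length (toList N′)
      ≤⟨ +-monoʳ-≤ (length Vs) (length-addRide (addRide-correct V N)) ⟩
    length Vs + suc (length (toList N))       ≡⟨ +-suc (length Vs) _ ⟩
    suc (length Vs + length (toList N))       ∎
    where N′ = value (addRide V N)

  -- Each call takes one ride off `Vs` and adds at most one node, so the sum of the two lengths
  -- never grows and a fixed `n` bounds the graph throughout.
  cost-addRides : ∀ {n} Vs N → length Vs + length (toList N) ≤ n →
                  cost (addRides Vs N) ≤ 1 + length Vs * (4 + 22 * n)
  cost-addRides []           N ≤n = s≤s z≤n
  cost-addRides {n} (V ∷ Vs) N ≤n = begin
    1 + (cost (addRide V N) + cost (addRides Vs N′))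
      ≤⟨ +-monoʳ-≤ 1 (+-mono-≤ (≤-trans (cost-addRide V N) (+-monoʳ-≤ 3 (*-monoʳ-≤ 22 N≤n)))
                               (cost-addRides Vs N′ Vs+N′≤n)) ⟩
    1 + (3 + 22 * n + (1 + length Vs * (4 + 22 * n)))
      ≡⟨ arith (length Vs) n ⟩
    1 + suc (length Vs) * (4 + 22 * n) ∎
    where
    N′ = value (addRide V N)

    N≤n : length (toList N) ≤ n
    N≤n = ≤-trans (m≤n+m _ (suc (length Vs))) ≤n

    Vs+N′≤n : length Vs + length (toList N′) ≤ n
    Vs+N′≤n = begin
      length Vs + length (toList N′)
        ≤⟨ +-monoʳ-≤ (length Vs) (length-addRide (addRide-correct V N)) ⟩
      length Vs + suc (length (toList N))  ≡⟨ +-suc (length Vs) _ ⟩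
      suc (length Vs + length (toList N))  ≤⟨ ≤n ⟩
      n                                    ∎

    arith : ∀ k n → 1 + (3 + 22 * n + (1 + k * (4 + 22 * n))) ≡ 1 + suc k * (4 + 22 * n)
    arith = solve-∀

  -- This invariant makes tracing back linear: the predecessor of a new node is already in the
  -- graph, so depth grows no faster than the number of nodes.
  Shallow : List⁺ Node → Set _
  Shallow N = All (λ M → depth M < length (toList N)) (toList N)

  addRide-shallow : ∀ {V N N′} → AddRide V N N′ → Shallow N → Shallow N′
  addRide-shallow (skipped _)     shallow = shallow
  addRide-shallow (added M∈N _ _) shallow =
    s≤s (All.lookup shallow M∈N) ∷ All.map m≤n⇒m≤1+n shallow

  addRides-shallow : ∀ Vs N → Shallow N → Shallow (value (addRides Vs N))
  addRides-shallow []       N shallow = shallow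
  addRides-shallow (V ∷ Vs) N shallow =
    addRides-shallow Vs _ (addRide-shallow (addRide-correct V N) shallow)

  -- The 20 are 19 operations in `sinkWeight`, which evaluates the final flight time and the travel
  -- time twice each, and the call.
  cost-sinkEdges : ∀ Ms → cost (sinkEdges Ms) ≡ 1 + 20 * length Ms
  cost-sinkEdges []       = ≡.refl
  cost-sinkEdges (M ∷ Ms) = begin-equality
    20 + (cost (sinkEdges Ms) + 0)  ≡⟨ ≡.cong (20 +_) (+-identityʳ _) ⟩
    20 + cost (sinkEdges Ms)        ≡⟨ ≡.cong (20 +_) (cost-sinkEdges Ms) ⟩
    20 + (1 + 20 * length Ms)       ≡⟨ arith (length Ms) ⟩
    1 + 20 * length (M ∷ Ms)        ∎
    where
    arith : ∀ n → 20 + (1 + 20 * n) ≡ 1 + 20 * suc n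
    arith = solve-∀

  length-sinkEdges : ∀ Ms → length (value (sinkEdges Ms)) ≡ length Ms
  length-sinkEdges []       = ≡.refl
  length-sinkEdges (_ ∷ Ms) = ≡.cong suc (length-sinkEdges Ms)

  n = length rides

  nodes≤1+n : length (toList nodes) ≤ suc n
  nodes≤1+n = begin
    length (toList nodes)  ≤⟨ length-addRides sorted [ origin ] ⟩
    length sorted + 1      ≡⟨ ≡.cong (_+ 1) (length-sort rides) ⟩
    n + 1                  ≡⟨ +-comm n 1 ⟩
    suc n                  ∎

  cost-addRides-sorted : cost (addRides sorted [ origin ]) ≤ 1 + n * (4 + 22 * suc n)
  cost-addRides-sorted = begin
    cost (addRides sorted [ origin ])
      ≤⟨ cost-addRides sorted [ origin ] sorted+1≤1+n ⟩
    1 + length sorted * (4 + 22 * suc n)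
      ≡⟨ ≡.cong (λ k → 1 + k * (4 + 22 * suc n)) (length-sort rides) ⟩
    1 + n * (4 + 22 * suc n) ∎
    where
    sorted+1≤1+n : length sorted + 1 ≤ suc n
    sorted+1≤1+n = ≤-reflexive (≡.trans (+-comm _ 1) (≡.cong suc (length-sort rides)))

  edges : List Keyed
  edges = value (sinkEdges (tail nodes))

  cost-best : cost (argmin preferLast (keyed (head nodes)) edges) ≤ 1 + 4 * n
  cost-best = begin
    cost (argmin preferLast (keyed (head nodes)) edges)
      ≡⟨ ArgMin.cost-select preferLast _ edges ⟩
    1 + 4 * length edges         ≡⟨ ≡.cong (λ k → 1 + 4 * k) (length-sinkEdges (tail nodes)) ⟩
    1 + 4 * length (tail nodes)  ≤⟨ +-monoʳ-≤ 1 (*-monoʳ-≤ 4 (s≤s⁻¹ nodes≤1+n)) ⟩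
    1 + 4 * n                    ∎

  cost-sinkEdges-tail : cost (sinkEdges (tail nodes)) ≤ 1 + 20 * n
  cost-sinkEdges-tail = begin
    cost (sinkEdges (tail nodes))  ≡⟨ cost-sinkEdges (tail nodes) ⟩
    1 + 20 * length (tail nodes)   ≤⟨ +-monoʳ-≤ 1 (*-monoʳ-≤ 20 (s≤s⁻¹ nodes≤1+n)) ⟩
    1 + 20 * n                     ∎

  cost-traceBack-best : cost (traceBack best []) ≤ 1 + n
  cost-traceBack-best = begin
    cost (traceBack best [])  ≡⟨ cost-traceBack best [] ⟩
    suc (depth best)
      ≤⟨ All.lookup (addRides-shallow sorted [ origin ] (s≤s z≤n ∷ [])) (proj₂ best∈nodes) ⟩
    length (toList nodes)     ≤⟨ nodes≤1+n ⟩
    suc n                     ∎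

  cost-optimalHitching : cost (OptimalHitching I τ) ≤ 24 * (n * n) + 54 * n + 24
  cost-optimalHitching = begin
    cost (OptimalHitching I τ)
      -- The `19` is `sinkWeight` of the head node, which is keyed apart from the tail. Of the
      -- leading 24, sorting contributes 2 and adding the rides 22.
      ≤⟨ +-mono-≤ (cost-sort rides ≤-refl) (+-mono-≤ cost-addRides-sorted
           (+-monoʳ-≤ 19 (+-mono-≤ cost-sinkEdges-tail (+-mono-≤ cost-best cost-traceBack-best)))) ⟩
    1 + n * (3 + 2 * n)
      + (1 + n * (4 + 22 * suc n) + (19 + (1 + 20 * n + (1 + 4 * n + (1 + n)))))
      ≡⟨ arith n ⟩
    24 * (n * n) + 54 * n + 24 ∎
    where
    arith : ∀ n → 1 + n * (3 + 2 * n)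
        + (1 + n * (4 + 22 * suc n) + (19 + (1 + 20 * n + (1 + 4 * n + (1 + n)))))
      ≡ 24 * (n * n) + 54 * n + 24
    arith = solve-∀

theorem2 : ∀ {c ℓ₁ ℓ₂} (F : OrderedField c ℓ₁ ℓ₂) →
    let open Hitching F in
    RunsInO {X = Problem × TieBreak} (λ n → n ^ 2)
    (λ (I , τ) → length (rides I))
    (λ (I , τ) → cost (OptimalHitching I τ))
    × (∀ (I : Problem) (τ : TieBreak) → IsOptimal I (value (OptimalHitching I τ)))
theorem2 F =
  -- The threshold `1` excludes the empty list of rides, where the cost is positive but `0 ^ 2` is
  -- not.
  (102 , 1 , λ (I , τ) 1≤n →
    NatArithmetic.≤-trans (NetworkCost.cost-optimalHitching F I τ)
                          (NatArithmetic.quadratic-bound 1≤n)) ,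
  Network.optimal F
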